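{- Let $\mathcal{F}$ be an $n$-periodic infinite frieze with quiddity sequence $q_{\mathcal{F}}=(a_1,a_2,\dots,a_n)$ and let $k\in\{1,2,\dots,n\}$. Then the $(n+1)$-tuple $$\hat q_{\mathcal{F}}^{\,n}=\begin{cases}(a_1+2,1)&\text{if }n=1,\\ (a_1,\dots,a_{k-1},a_k+1,1,a_{k+1}+1,a_{k+2},\dots,a_n)&\text{otherwise},\end{cases}$$ where indices are taken modulo $n$, is the quiddity sequence of an infinite frieze $\widehat{\mathcal{F}}^n$ of period $n+1$.
   Context: An infinite frieze is an array $(m_{ij})_{i,j\in\mathbb{Z},\,j-i\ge -2}$ of integers with $m_{i,i-2}=0$ and $m_{i,i-1}=1$ for all $i\in\mathbb{Z}$, $m_{ij}>0$ for all $j\ge i$, and $m_{ij}m_{i+1,j+1}-m_{i+1,j}m_{i,j+1}=1$ for all $j-i\ge -1$. For an integer $n\ge1$ it is $n$-periodic (of period $n$; $n$ need not be the minimal period) if $m_{ij}=m_{i+n,j+n}$ for all $i\le j$. The quiddity sequence of an $n$-periodic infinite frieze is the $n$-tuple $(a_1,\dots,a_n)$, determined up to cyclic equivalence, with $a_i=m_{ii}$. "Indices modulo $n$" in the tuple means: for $n\ge 2$ and $k=n$ the tuple is $(a_1+1,a_2,\dots,a_{n-1},a_n+1,1)$. -}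

module Defs where

open import Data.Fin.Base using (Fin; toℕ)
import Data.Fin.Base as Fin
open import Data.Integer.Base
  using (ℤ; +_; 0ℤ; 1ℤ; -1ℤ; _+_; _-_; _*_; _≤_; _<_)
open import Data.Nat.Base using (ℕ; zero; suc; NonZero)
import Data.Nat.Base as ℕ
open import Data.Nat.DivMod using (_mod_)
open import Data.Product.Base using (∃-syntax)
open import Data.Vec.Base
  using (Vec; []; _∷_; lookup; tabulate; insertAt; updateAt)
open import Relation.Binary.PropositionalEquality.Core using (_≡_)

-- The array is only defined for j - i ≥ -2.  It is encoded as a total
-- function whose values outside that region are unconstrained: every law
-- below mentions only entries with j - i ≥ -2.

record InfiniteFrieze : Set where
  field
    m        : ℤ → ℤ → ℤ
    zeros    : ∀ i → m i (i - + 2) ≡ 0ℤ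
    ones     : ∀ i → m i (i - + 1) ≡ 1ℤ
    positive : ∀ i j → i ≤ j → 0ℤ < m i j
    diamond  : ∀ i j → -1ℤ ≤ j - i →
               m i j * m (i + 1ℤ) (j + 1ℤ) - m (i + 1ℤ) j * m i (j + 1ℤ) ≡ 1ℤ

open InfiniteFrieze public

-- n need not be the minimal period.

Periodic : ℕ → InfiniteFrieze → Set
Periodic n F = ∀ i j → i ≤ j → m F i j ≡ m F (i + + n) (j + + n)

-- Position p : Fin n of a tuple (a₁ , … , aₙ) holds a_{p+1}.

quiddity : ∀ n → InfiniteFrieze → Vec ℤ n
quiddity n F = tabulate λ p → m F (+ suc (toℕ p)) (+ suc (toℕ p))

CyclicallyEquivalent : ∀ {n} .{{_ : NonZero n}} → Vec ℤ n → Vec ℤ n → Set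
CyclicallyEquivalent {n} q r =
  ∃[ s ] ∀ (p : Fin n) → lookup q p ≡ lookup r ((toℕ p ℕ.+ s) mod n)

-- Intended for F satisfying Periodic n F, whose quiddity sequence is only
-- determined up to cyclic equivalence.

IsQuidditySequence : ∀ {n} .{{_ : NonZero n}} → Vec ℤ n → InfiniteFrieze → Set
IsQuidditySequence {n} q F = CyclicallyEquivalent q (quiddity n F)

-- The index p : Fin n stands for k = p + 1, so (toℕ p + 1) mod n is the
-- position of a_{k+1}, which is a₁ when k = n; the new entry 1 always comes
-- directly after a_k, hence last when k = n.

q̂ : ∀ {n} → Vec ℤ n → Fin n → Vec ℤ (suc n)
q̂ {suc zero}      (a ∷ []) _ = a + + 2 ∷ 1ℤ ∷ []
q̂ {n@(suc (suc _))} q      p =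
  insertAt (updateAt (updateAt q p (_+ 1ℤ)) (suc (toℕ p) mod n) (_+ 1ℤ))
           (Fin.suc p) 1ℤ

-- Extended antisymmetrically, the entries λ(v,w) = m_{v+1,w-1} form an array on
-- ℤ × ℤ with diagonal 0, superdiagonal 1, positive entries above the diagonal and
-- all adjacent 2 × 2 minors equal to 1.  Between two consecutive vertices v, v+1
-- one may insert a vertex acting as their sum, extending λ bilinearly: minors
-- only change by row and column operations, and positivity above the diagonal is
-- preserved.  The inserted vertex has quiddity λ(v,v+1) = 1, and the
-- quiddities of v and v+1 grow by 1.  Inserting one such vertex per period
-- yields the required frieze.

module Submission where

open import Data.Empty using (⊥-elim)
open import Data.Fin.Base as Fin using (Fin; toℕ)
open import Data.Fin.Properties as Fin using (toℕ-injective; toℕ<n)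
open import Data.Integer.Base hiding (NonZero; positive) renaming (suc to sucℤ)
open import Data.Integer.DivMod using (n%ℕd<d; a≡a%ℕn+[a/ℕn]*n)
open import Data.Integer.Properties
open import Data.Integer.Tactic.RingSolver using (solve-∀)
open import Data.Nat.Base as ℕ using (ℕ; zero; suc; NonZero)
import Data.Nat.DivMod as ℕ
open import Data.Nat.DivMod using (_mod_)
import Data.Nat.Properties as ℕ
open import Data.Nat.Tactic.RingSolver using () renaming (solve-∀ to ℕ-solve-∀)
open import Data.Product.Base using (_×_; _,_; ∃-syntax)
open import Data.Sum.Base using (inj₁; inj₂)
open import Data.Vec.Base using (Vec; []; _∷_; lookup; insertAt; updateAt)
open import Data.Vec.Properties
  using (lookup∘tabulate; lookup∘updateAt; lookup∘updateAt′; insertAt-lookup; insertAt-punchIn)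
open import Defs
open import Relation.Binary.Definitions using (tri<; tri≈; tri>)
open import Relation.Binary.PropositionalEquality
open import Relation.Nullary using (Dec; yes; no)

-- Integer order and arithmetic.

i<i+1 : ∀ i → i < i + 1ℤ
i<i+1 i = subst (_< i + 1ℤ) (+-identityʳ i) (+-monoʳ-< i (+<+ (ℕ.s≤s ℕ.z≤n)))

+-swapʳ : ∀ i j k → i + j + k ≡ i + k + j
+-swapʳ = solve-∀

i-1+1≡i : ∀ i → i - 1ℤ + 1ℤ ≡ i
i-1+1≡i = solve-∀

i+1-1≡i : ∀ i → i + 1ℤ - 1ℤ ≡ i
i+1-1≡i = solve-∀

i<j⇒i+1≤j : ∀ {i j} → i < j → i + 1ℤ ≤ j
i<j⇒i+1≤j {i} {j} i<j = subst (_≤ j) (+-comm 1ℤ i) (i<j⇒suc[i]≤j i<j)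

-- Antisymmetric tilings of the plane with unit minors.

Wronskian : (f g : ℤ → ℤ) → Set
Wronskian f g = ∀ i → f i * g (i + 1ℤ) - f (i + 1ℤ) * g i ≡ 1ℤ

-- An antisymmetric SL2-tiling. Being total on pairs of integers, it lets sums of neighbouring rows
-- and columns be taken across the diagonal without side conditions.
record Tiling : Set where
  field
    entry     : ℤ → ℤ → ℤ
    antisym   : ∀ i j → entry j i ≡ - entry i j
    superdiag : ∀ i → entry i (i + 1ℤ) ≡ 1ℤ
    entry-pos : ∀ {i j} → i < j → 0ℤ < entry i j
    det       : ∀ j → Wronskian (λ i → entry i j) (λ i → entry i (j + 1ℤ))

open Tiling

i≡-i⇒i≡0 : ∀ {i} → i ≡ - i → i ≡ 0ℤ
i≡-i⇒i≡0 {+0} _ = refl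

diag : ∀ T i → entry T i i ≡ 0ℤ
diag T i = i≡-i⇒i≡0 (antisym T i i)

pos-≤ : ∀ T {i j} → i ≤ j → 0ℤ ≤ entry T i j
pos-≤ T {i} {j} i≤j with i ≟ j
... | yes refl = ≤-reflexive (sym (diag T i))
... | no i≢j   = <⇒≤ (entry-pos T (≤∧≢⇒< i≤j i≢j))

TilingPeriodic : ℕ → Tiling → Set
TilingPeriodic n T = ∀ i j → entry T (i + + n) (j + + n) ≡ entry T i j

-- From friezes to tilings.

module _ (F : InfiniteFrieze) where

  upper : ℤ → ℤ → ℤ
  upper i j = m F (i + 1ℤ) (j - 1ℤ)

  upper-diag : ∀ i → upper i i ≡ 0ℤ
  upper-diag i = trans (cong (m F (i + 1ℤ)) (e i)) (zeros F (i + 1ℤ))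
    where
    e : ∀ i → i - 1ℤ ≡ i + 1ℤ - + 2
    e = solve-∀

  upper-superdiag : ∀ i → upper i (i + 1ℤ) ≡ 1ℤ
  upper-superdiag i = ones F (i + 1ℤ)

  upper-pos : ∀ {i j} → i < j → 0ℤ < upper i j
  upper-pos {i} {j} i<j with i + 1ℤ ≟ j
  ... | yes refl = subst (0ℤ <_) (sym (upper-superdiag i)) (+<+ (ℕ.s≤s ℕ.z≤n))
  ... | no i+1≢j = positive F _ _
          (subst (_≤ j - 1ℤ) (i+1-1≡i (i + 1ℤ))
            (+-monoˡ-≤ -1ℤ (i<j⇒i+1≤j (≤∧≢⇒< (i<j⇒i+1≤j i<j) i+1≢j))))

  upper-det : ∀ {i j} → i < j →
              upper i j * upper (i + 1ℤ) (j + 1ℤ)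
                - upper (i + 1ℤ) j * upper i (j + 1ℤ) ≡ 1ℤ
  upper-det {i} {j} i<j =
    subst (λ x → upper i j * m F (i + 1ℤ + 1ℤ) x
                   - upper (i + 1ℤ) j * m F (i + 1ℤ) x ≡ 1ℤ)
          (+-swapʳ j -1ℤ 1ℤ)
          -- In these coordinates the side condition reads `-1ℤ ≤ (j - 1) - (i + 1)`, which is
          -- exactly `i < j`.
          (diamond F (i + 1ℤ) (j - 1ℤ)
            (subst (-1ℤ ≤_) (+-swapʳ j (- (i + 1ℤ)) -1ℤ)
              (+-monoˡ-≤ -1ℤ (i≤j⇒0≤j-i (i<j⇒i+1≤j i<j)))))

  friezeEntry : ℤ → ℤ → ℤ
  friezeEntry i j with i ≤? j
  ... | yes _ = upper i j
  ... | no  _ = - upper j i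

  friezeEntry-≤ : ∀ {i j} → i ≤ j → friezeEntry i j ≡ upper i j
  friezeEntry-≤ {i} {j} i≤j with i ≤? j
  ... | yes _   = refl
  ... | no  i≰j = ⊥-elim (i≰j i≤j)

  friezeEntry-≥ : ∀ {i j} → j ≤ i → friezeEntry i j ≡ - upper j i
  friezeEntry-≥ {i} {j} j≤i with i ≤? j
  ... | no  _   = refl
  ... | yes i≤j with refl ← ≤-antisym i≤j j≤i =
          trans (upper-diag i) (cong -_ (sym (upper-diag i)))

  friezeEntry-antisym : ∀ i j → friezeEntry j i ≡ - friezeEntry i j
  friezeEntry-antisym i j with ≤-total i j
  ... | inj₁ i≤j = trans (friezeEntry-≥ i≤j) (cong -_ (sym (friezeEntry-≤ i≤j)))
  ... | inj₂ j≤i = trans (friezeEntry-≤ j≤i)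
          (trans (sym (neg-involutive _)) (cong -_ (sym (friezeEntry-≥ j≤i))))

  friezeTiling : Tiling
  friezeTiling .entry = friezeEntry
  friezeTiling .antisym = friezeEntry-antisym
  friezeTiling .superdiag i =
    trans (friezeEntry-≤ (<⇒≤ (i<i+1 i))) (upper-superdiag i)
  friezeTiling .entry-pos i<j = subst (0ℤ <_) (sym (friezeEntry-≤ (<⇒≤ i<j))) (upper-pos i<j)
  -- Above the diagonal this is the frieze rule. On it the minor is `0 * 0 - (-1) * 1`. Below it the
  -- minor is the transpose of one above, the signs cancelling in each product.
  friezeTiling .det j i with <-cmp i j
  ... | tri< i<j _ _
        rewrite friezeEntry-≤ (<⇒≤ i<j)
              | friezeEntry-≤ (+-monoˡ-≤ 1ℤ (<⇒≤ i<j))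
              | friezeEntry-≤ (i<j⇒i+1≤j i<j)
              | friezeEntry-≤ (≤-trans (<⇒≤ i<j) (<⇒≤ (i<i+1 j))) = upper-det i<j
  ... | tri≈ _ refl _
        rewrite friezeEntry-≤ (≤-refl {i})
              | friezeEntry-≤ (≤-refl {i + 1ℤ})
              | friezeEntry-≤ (<⇒≤ (i<i+1 i))
              | friezeEntry-≥ (<⇒≤ (i<i+1 i))
              | upper-diag i | upper-superdiag i = refl
  ... | tri> _ _ j<i
        rewrite friezeEntry-≥ (<⇒≤ j<i)
              | friezeEntry-≥ (+-monoˡ-≤ 1ℤ (<⇒≤ j<i))
              | friezeEntry-≥ (i<j⇒i+1≤j j<i)
              | friezeEntry-≥ (≤-trans (<⇒≤ j<i) (<⇒≤ (i<i+1 i))) =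
          trans (e (upper j i) (upper (j + 1ℤ) (i + 1ℤ)) (upper j (i + 1ℤ)) (upper (j + 1ℤ) i))
                (upper-det j<i)
    where
    e : ∀ a b c d → (- a) * (- b) - (- c) * (- d) ≡ a * b - d * c
    e = solve-∀

  module _ {n} (periodic : Periodic n F) where

    -- `Periodic` speaks only of the positive part of the frieze; on the two boundary diagonals
    -- periodicity comes from the constants 0 and 1.
    upper-periodic : ∀ {i j} → i ≤ j → upper (i + + n) (j + + n) ≡ upper i j
    upper-periodic {i} {j} i≤j with i ≟ j
    ... | yes refl = trans (upper-diag (i + + n)) (sym (upper-diag i))
    ... | no i≢j with i + 1ℤ ≟ j
    ...   | yes refl =
            trans (cong (upper (i + + n)) (+-swapʳ i 1ℤ (+ n)))
              (trans (upper-superdiag (i + + n)) (sym (upper-superdiag i)))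
    ...   | no i+1≢j =
            trans (cong₂ (m F) (+-swapʳ i (+ n) 1ℤ) (+-swapʳ j (+ n) -1ℤ))
              (sym (periodic (i + 1ℤ) (j - 1ℤ)
                (subst (_≤ j - 1ℤ) (i+1-1≡i (i + 1ℤ))
                  (+-monoˡ-≤ -1ℤ (i<j⇒i+1≤j (≤∧≢⇒< (i<j⇒i+1≤j (≤∧≢⇒< i≤j i≢j)) i+1≢j))))))

    friezeTiling-periodic : TilingPeriodic n friezeTiling
    friezeTiling-periodic i j with ≤-total i j
    ... | inj₁ i≤j
          rewrite friezeEntry-≤ i≤j
                | friezeEntry-≤ (+-monoˡ-≤ (+ n) i≤j) = upper-periodic i≤j
    ... | inj₂ j≤i
          rewrite friezeEntry-≥ j≤i
                | friezeEntry-≥ (+-monoˡ-≤ (+ n) j≤i) = cong -_ (upper-periodic j≤i)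

  friezeTiling-quiddity : ∀ i → entry friezeTiling (i - 1ℤ) (i + 1ℤ) ≡ m F i i
  friezeTiling-quiddity i =
    trans (friezeEntry-≤ (≤-trans (i-j≤i i 1ℤ) (<⇒≤ (i<i+1 i))))
          (cong₂ (m F) (i-1+1≡i i) (i+1-1≡i i))

-- From tilings back to friezes, and translation of tilings.

tilingFrieze : Tiling → InfiniteFrieze
tilingFrieze T .m i j = entry T (i - 1ℤ) (j + 1ℤ)
tilingFrieze T .zeros i = trans (cong (entry T (i - 1ℤ)) (e i)) (diag T (i - 1ℤ))
  where
  e : ∀ i → i - + 2 + 1ℤ ≡ i - 1ℤ
  e = solve-∀
tilingFrieze T .ones i = superdiag T (i - 1ℤ)
tilingFrieze T .positive i j i≤j =
  entry-pos T (≤-<-trans (i-j≤i i 1ℤ) (≤-<-trans i≤j (i<i+1 j)))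
tilingFrieze T .diamond i j _ =
  subst (λ x → entry T (i - 1ℤ) (j + 1ℤ) * entry T x (j + 1ℤ + 1ℤ)
                 - entry T x (j + 1ℤ) * entry T (i - 1ℤ) (j + 1ℤ + 1ℤ) ≡ 1ℤ)
        (+-swapʳ i -1ℤ 1ℤ) (det T (j + 1ℤ) (i - 1ℤ))

tilingFrieze-periodic : ∀ {n} T → TilingPeriodic n T → Periodic n (tilingFrieze T)
tilingFrieze-periodic {n} T periodic i j _ =
  trans (sym (periodic (i - 1ℤ) (j + 1ℤ))) (cong₂ (entry T) (+-swapʳ i -1ℤ (+ n)) (+-swapʳ j 1ℤ (+ n)))

-- Moves the chosen gap to a standard place, so that vertices need to be inserted there only.
shift : ℤ → Tiling → Tiling
shift c T .entry i j = entry T (i + c) (j + c)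
shift c T .antisym i j = antisym T (i + c) (j + c)
shift c T .superdiag i =
  trans (cong (entry T (i + c)) (+-swapʳ i 1ℤ c)) (superdiag T (i + c))
shift c T .entry-pos i<j = entry-pos T (+-monoˡ-< c i<j)
shift c T .det j i =
  subst₂ (λ x y → entry T (i + c) (j + c) * entry T x y
                 - entry T x (j + c) * entry T (i + c) y ≡ 1ℤ)
         (+-swapʳ i c 1ℤ) (+-swapʳ j c 1ℤ) (det T (j + c) (i + c))

shift-periodic : ∀ {n} c T → TilingPeriodic n T → TilingPeriodic n (shift c T)
shift-periodic {n} c T periodic i j =
  trans (cong₂ (entry T) (+-swapʳ i (+ n) c) (+-swapʳ j (+ n) c)) (periodic (i + c) (j + c))

-- Inserted vertices and linear extension.

-- mid i is the vertex inserted between i and i + 1, acting as their sum.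
data Vertex : Set where
  at mid : ℤ → Vertex

-- Consecutive vertices of a refinement in which each gap may or may not be subdivided: `along`
-- crosses an undivided gap, `enter` and `leave` the two halves of a divided one.
data Step : Vertex → Vertex → Set where
  along : ∀ {i} → Step (at i) (at (i + 1ℤ))
  enter : ∀ {i} → Step (at i) (mid i)
  leave : ∀ {i} → Step (mid i) (at (i + 1ℤ))

extend : (ℤ → ℤ) → Vertex → ℤ
extend f (at i)  = f i
extend f (mid i) = f i + f (i + 1ℤ)

-- A 2 × 2 determinant does not change when one of its two lines is replaced by the sum of both.
extend-wronskian : ∀ {f g} → Wronskian f g → ∀ {v w} → Step v w →
                   extend f v * extend g w - extend f w * extend g v ≡ 1ℤ
extend-wronskian W {at i}  along = W i
extend-wronskian {f} {g} W {at i}  enter =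
  trans (e (f i) (f (i + 1ℤ)) (g i) (g (i + 1ℤ))) (W i)
  where
  e : ∀ a b c d → a * (c + d) - (a + b) * c ≡ a * d - b * c
  e = solve-∀
extend-wronskian {f} {g} W {mid i} leave =
  trans (e (f i) (f (i + 1ℤ)) (g i) (g (i + 1ℤ))) (W i)
  where
  e : ∀ a b c d → (a + b) * d - b * (c + d) ≡ a * d - b * c
  e = solve-∀

-- The linear order with `mid i` between `at i` and `at (i + 1ℤ)`; only `at≺mid` allows equal
-- indices, since `at i` precedes its own `mid i`.
data _≺_ : Vertex → Vertex → Set where
  at≺at   : ∀ {i j} → i < j → at i ≺ at j
  at≺mid  : ∀ {i j} → i ≤ j → at i ≺ mid j
  mid≺at  : ∀ {i j} → i < j → mid i ≺ at j
  mid≺mid : ∀ {i j} → i < j → mid i ≺ mid j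

step⇒≺ : ∀ {v w} → Step v w → v ≺ w
step⇒≺ along = at≺at (i<i+1 _)
step⇒≺ enter = at≺mid ≤-refl
step⇒≺ leave = mid≺at (i<i+1 _)

≺-step : ∀ {u v w} → u ≺ v → Step v w → u ≺ w
≺-step (at≺at i<j)   along = at≺at (<-trans i<j (i<i+1 _))
≺-step (at≺at i<j)   enter = at≺mid (<⇒≤ i<j)
≺-step (at≺mid i≤j)  leave = at≺at (≤-<-trans i≤j (i<i+1 _))
≺-step (mid≺at i<j)  along = mid≺at (<-trans i<j (i<i+1 _))
≺-step (mid≺at i<j)  enter = mid≺mid i<j
≺-step (mid≺mid i<j) leave = mid≺at (<-trans i<j (i<i+1 _))

-- What a neighbour of this kind adds to the quiddity of an old vertex.
weight : Vertex → ℤ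
weight (at _)  = 0ℤ
weight (mid _) = 1ℤ

-- The bilinear extension of a tiling and its refinements.

module _ (T : Tiling) where

  bracket : Vertex → Vertex → ℤ
  bracket v w = extend (λ j → extend (λ i → entry T i j) v) w

  bracket-antisym : ∀ v w → bracket w v ≡ - bracket v w
  bracket-antisym (at i)  (at j)  = antisym T i j
  bracket-antisym (at i)  (mid j)
    rewrite antisym T i j | antisym T i (j + 1ℤ) = sym (neg-distrib-+ (entry T i j) _)
  bracket-antisym (mid i) (at j)
    rewrite antisym T i j | antisym T (i + 1ℤ) j = sym (neg-distrib-+ (entry T i j) _)
  bracket-antisym (mid i) (mid j)
    rewrite antisym T i j | antisym T (i + 1ℤ) j
          | antisym T i (j + 1ℤ) | antisym T (i + 1ℤ) (j + 1ℤ) =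
      e (entry T i j) _ _ _
    where
    e : ∀ a b c d → (- a + - c) + (- b + - d) ≡ - ((a + b) + (c + d))
    e = solve-∀

  bracket-step : ∀ {v w} → Step v w → bracket v w ≡ 1ℤ
  bracket-step (along {i}) = superdiag T i
  bracket-step (enter {i}) rewrite diag T i | superdiag T i = refl
  bracket-step (leave {i}) rewrite diag T (i + 1ℤ) | superdiag T i = refl

  -- The bracket expands into entries on or above the diagonal, at least one of them strictly above.
  bracket-pos : ∀ {v w} → v ≺ w → 0ℤ < bracket v w
  bracket-pos (at≺at i<j)   = entry-pos T i<j
  bracket-pos (at≺mid i≤j)  =
    +-mono-≤-< (pos-≤ T i≤j) (entry-pos T (≤-<-trans i≤j (i<i+1 _)))
  bracket-pos (mid≺at i<j)  =
    +-mono-<-≤ (entry-pos T i<j) (pos-≤ T (i<j⇒i+1≤j i<j))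
  bracket-pos (mid≺mid i<j) =
    +-mono-< (+-mono-<-≤ (entry-pos T i<j) (pos-≤ T (i<j⇒i+1≤j i<j)))
             (+-mono-< (entry-pos T (<-trans i<j (i<i+1 _)))
                       (entry-pos T (+-monoˡ-< 1ℤ i<j)))

  -- `extend-wronskian` is applied twice, first to the row index for each fixed pair of columns,
  -- then to the column index; the commutations transpose the minor in between.
  bracket-det : ∀ {v v′ w w′} → Step v v′ → Step w w′ →
                bracket v w * bracket v′ w′ - bracket v′ w * bracket v w′ ≡ 1ℤ
  bracket-det {v} {v′} {w} {w′} s t =
    trans (cong (λ x → bracket v w * bracket v′ w′ - x) (*-comm (bracket v′ w) _))
      (extend-wronskian (λ j →
        trans (cong (λ x → row v j * row v′ (j + 1ℤ) - x) (*-comm (row v (j + 1ℤ)) (row v′ j)))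
              (extend-wronskian (det T j) s)) t)
    where
    row : Vertex → ℤ → ℤ
    row v j = extend (λ i → entry T i j) v

  -- An inserted neighbour is the old neighbour plus `i` itself. By bilinearity the extra terms are
  -- superdiagonal entries, equal to 1, and, if both neighbours are inserted, also the diagonal
  -- entry 0.
  bracket-corner : ∀ {u i w} → Step u (at i) → Step (at i) w →
                   bracket u w ≡ entry T (i - 1ℤ) (i + 1ℤ) + weight u + weight w
  bracket-corner (along {i}) along rewrite i+1-1≡i i = e (entry T i (i + 1ℤ + 1ℤ))
    where
    e : ∀ a → a ≡ a + 0ℤ + 0ℤ
    e = solve-∀
  bracket-corner (along {i}) enter rewrite i+1-1≡i i | superdiag T i = e (entry T i (i + 1ℤ + 1ℤ))
    where
    e : ∀ a → 1ℤ + a ≡ a + 0ℤ + 1ℤ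
    e = solve-∀
  bracket-corner (leave {i}) along rewrite i+1-1≡i i | superdiag T (i + 1ℤ) = e (entry T i (i + 1ℤ + 1ℤ))
    where
    e : ∀ a → a + 1ℤ ≡ a + 1ℤ + 0ℤ
    e = solve-∀
  bracket-corner (leave {i}) enter
    rewrite i+1-1≡i i | superdiag T i | superdiag T (i + 1ℤ) | diag T (i + 1ℤ) = e (entry T i (i + 1ℤ + 1ℤ))
    where
    e : ∀ a → 1ℤ + 0ℤ + (a + 1ℤ) ≡ a + 1ℤ + 1ℤ
    e = solve-∀

  bracket-ear : ∀ {u i w} → Step u (mid i) → Step (mid i) w → bracket u w ≡ 1ℤ
  bracket-ear enter leave = superdiag T _

  module _ (σ : ℤ → Vertex) (σ-step : ∀ i → Step (σ i) (σ (i + 1ℤ))) where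

    σ-≺ : ∀ {i j} → i < j → σ i ≺ σ j
    σ-≺ {i} {j} i<j =
      subst (λ x → σ i ≺ σ x) e (go ∣ j - (i + 1ℤ) ∣)
      where
      go : ∀ d → σ i ≺ σ (i + 1ℤ + + d)
      go zero = subst (λ x → σ i ≺ σ x) (sym (+-identityʳ (i + 1ℤ))) (step⇒≺ (σ-step i))
      go (suc d) =
        subst (λ x → σ i ≺ σ x) (f (i + 1ℤ) (+ d)) (≺-step (go d) (σ-step _))
        where
        f : ∀ i d → i + d + 1ℤ ≡ i + (1ℤ + d)
        f = solve-∀
      g : ∀ k j → k + (j - k) ≡ j
      g = solve-∀
      e : i + 1ℤ + + ∣ j - (i + 1ℤ) ∣ ≡ j
      e = trans (cong (_+_ (i + 1ℤ)) (0≤i⇒+∣i∣≡i (i≤j⇒0≤j-i (i<j⇒i+1≤j i<j)))) (g (i + 1ℤ) j)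

    -- The tiling laws use only that consecutive indices take a `Step`; which gaps are divided is
    -- left to `σ`.
    refine : Tiling
    refine .entry i j = bracket (σ i) (σ j)
    refine .antisym i j = bracket-antisym (σ i) (σ j)
    refine .superdiag i = bracket-step (σ-step i)
    refine .entry-pos i<j = bracket-pos (σ-≺ i<j)
    refine .det j i = bracket-det (σ-step i) (σ-step j)

-- Uniqueness of Euclidean division, and indicators.

quotient-≤ : ∀ {r d} q q′ {r′} → r ℕ.< d → + r + q * + d ≡ + r′ + q′ * + d → q′ ≤ q
quotient-≤ {r} {d@(suc _)} q q′ {r′} r<d eq =
  subst (q′ ≤_) (pred-suc q) (i<j⇒i≤pred[j] {q′} {sucℤ q} (*-cancelʳ-<-nonNeg {q′} {sucℤ q} (+ d) (begin-strict
    q′ * + d          ≤⟨ i≤j+i (q′ * + d) (+ r′) ⟩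
    + r′ + q′ * + d   ≡⟨ eq ⟨
    + r + q * + d     <⟨ +-monoˡ-< (q * + d) (+<+ r<d) ⟩
    + d + q * + d     ≡⟨ suc-* q (+ d) ⟨
    sucℤ q * + d      ∎)))
  where
  open ≤-Reasoning

module _ (d : ℕ) .{{_ : NonZero d}} (q : ℤ) {r : ℕ} (r<d : r ℕ.< d) where

  private
    i : ℤ
    i = + r + q * + d

  [r+q*d]/d≡q : i /ℕ d ≡ q
  [r+q*d]/d≡q = ≤-antisym
    (quotient-≤ q (i /ℕ d) r<d (a≡a%ℕn+[a/ℕn]*n i d))
    (quotient-≤ (i /ℕ d) q (n%ℕd<d i d) (sym (a≡a%ℕn+[a/ℕn]*n i d)))

  [r+q*d]%d≡r : i %ℕ d ≡ r
  [r+q*d]%d≡r = +-injective (+-cancelʳ (q * + d) (+ (i %ℕ d)) (+ r)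
    (trans (cong (λ x → + (i %ℕ d) + x * + d) (sym [r+q*d]/d≡q)) (sym (a≡a%ℕn+[a/ℕn]*n i d))))
    where open import Algebra.Properties.AbelianGroup +-0-abelianGroup using () renaming (∙-cancelʳ to +-cancelʳ)

-- Both increments of the quiddity are written as indicators, so the comparison also covers `n = 1`,
-- where they fall on the same entry and add up to 2.
indicator : ∀ {P : Set} → Dec P → ℤ
indicator (yes _) = 1ℤ
indicator (no  _) = 0ℤ

indicator-⇔ : ∀ {P Q : Set} → (P → Q) → (Q → P) → (p : Dec P) (q : Dec Q) →
              indicator p ≡ indicator q
indicator-⇔ f g (yes _) (yes _) = refl
indicator-⇔ f g (no _)  (no _)  = refl
indicator-⇔ f g (yes p) (no ¬q) = ⊥-elim (¬q (f p))
indicator-⇔ f g (no ¬p) (yes q) = ⊥-elim (¬p (g q))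

-- Enumerating the vertices with one insertion per period.

module _ (ℓ : ℕ) where

  private
    n N : ℕ
    n = suc ℓ
    N = suc n

  -- Position r + x N of the new numbering: the new vertices have r = 0.
  vertex : ℕ → ℤ → Vertex
  vertex zero    x = mid (x * + n - 1ℤ)
  vertex (suc r) x = at (+ r + x * + n)

  σ : ℤ → Vertex
  σ i = vertex (i %ℕ N) (i /ℕ N)

  σ-decompose : ∀ {r} x → r ℕ.< N → σ (+ r + x * + N) ≡ vertex r x
  σ-decompose x r<N = cong₂ vertex ([r+q*d]%d≡r N x r<N) ([r+q*d]/d≡q N x r<N)

  -- A view: matching on it puts an index into the form on which `σ-decompose` computes `σ`.
  data Decomposition : ℤ → Set where
    decompose : ∀ {r} x → r ℕ.< N → Decomposition (+ r + x * + N)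

  decomposition : ∀ i → Decomposition i
  decomposition i = subst Decomposition (sym (a≡a%ℕn+[a/ℕn]*n i N))
    (decompose (i /ℕ N) (n%ℕd<d i N))

  σ-suc : ∀ {r} x → r ℕ.< n → σ (+ r + x * + N + 1ℤ) ≡ vertex (suc r) x
  σ-suc {r} x r<n = trans (cong σ (e (+ r) (x * + N))) (σ-decompose x (ℕ.s≤s r<n))
    where
    e : ∀ r y → r + y + 1ℤ ≡ 1ℤ + r + y
    e = solve-∀

  σ-wrap : ∀ x → σ (+ n + x * + N + 1ℤ) ≡ vertex 0 (x + 1ℤ)
  σ-wrap x = trans (cong σ (e (+ n) x)) (σ-decompose (x + 1ℤ) ℕ.z<s)
    where
    e : ∀ n x → n + x * (1ℤ + n) + 1ℤ ≡ 0ℤ + (x + 1ℤ) * (1ℤ + n)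
    e = solve-∀

  -- Block `x` consists of `mid (x n - 1)`, `at (x n)`, ..., `at (x n + n - 1)`. It starts with
  -- `leave`, continues with `along`, and passes to the next block by `enter`.
  σ-step : ∀ i → Step (σ i) (σ (i + 1ℤ))
  σ-step i with decomposition i
  ... | decompose {r} x r<N with ℕ.m≤n⇒m<n∨m≡n (ℕ.s≤s⁻¹ r<N)
  ...   | inj₁ r<n rewrite σ-decompose x r<N | σ-suc x r<n = go r
    where
    e : ∀ y → y - 1ℤ + 1ℤ ≡ 0ℤ + y
    e = solve-∀
    f : ∀ r y → r + y + 1ℤ ≡ 1ℤ + r + y
    f = solve-∀
    go : ∀ r → Step (vertex r x) (vertex (suc r) x)
    go zero    = subst (λ j → Step (vertex 0 x) (at j)) (e (x * + n)) leave
    go (suc r) = subst (λ j → Step (vertex (suc r) x) (at j)) (f (+ r) (x * + n)) along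
  ...   | inj₂ refl rewrite σ-decompose x r<N | σ-wrap x =
    subst (λ j → Step (vertex n x) (mid j)) (e (+ ℓ) x) enter
    where
    e : ∀ ℓ x → ℓ + x * (1ℤ + ℓ) ≡ (x + 1ℤ) * (1ℤ + ℓ) - 1ℤ
    e = solve-∀

  translate : Vertex → Vertex
  translate (at i)  = at (i + + n)
  translate (mid i) = mid (i + + n)

  vertex-translate : ∀ r x → vertex r (x + 1ℤ) ≡ translate (vertex r x)
  vertex-translate zero    x = cong mid (e x (+ n))
    where
    e : ∀ x n → (x + 1ℤ) * n - 1ℤ ≡ x * n - 1ℤ + n
    e = solve-∀
  vertex-translate (suc r) x = cong at (e (+ r) x (+ n))
    where
    e : ∀ r x n → r + (x + 1ℤ) * n ≡ r + x * n + n
    e = solve-∀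

  -- A block of `N` new indices covers `n` old vertices and one inserted vertex, so the next block
  -- is its translate by `n`.
  σ-translate : ∀ i → σ (i + + N) ≡ translate (σ i)
  σ-translate i with decomposition i
  ... | decompose {r} x r<N = begin
    σ (+ r + x * + N + + N)       ≡⟨ cong σ (e (+ r) x (+ N)) ⟩
    σ (+ r + (x + 1ℤ) * + N)      ≡⟨ σ-decompose (x + 1ℤ) r<N ⟩
    vertex r (x + 1ℤ)             ≡⟨ vertex-translate r x ⟩
    translate (vertex r x)        ≡⟨ cong translate (σ-decompose x r<N) ⟨
    translate (σ (+ r + x * + N)) ∎
    where
    open ≡-Reasoning
    e : ∀ r x N → r + x * N + N ≡ r + (x + 1ℤ) * N
    e = solve-∀

  bracket-translate : ∀ T → TilingPeriodic n T → ∀ v w →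
                      bracket T (translate v) (translate w) ≡ bracket T v w
  bracket-translate T periodic (at i)  (at j)  = periodic i j
  bracket-translate T periodic (at i)  (mid j)
    rewrite sym (+-swapʳ j 1ℤ (+ n)) | periodic i j | periodic i (j + 1ℤ) = refl
  bracket-translate T periodic (mid i) (at j)
    rewrite sym (+-swapʳ i 1ℤ (+ n)) | periodic i j | periodic (i + 1ℤ) j = refl
  bracket-translate T periodic (mid i) (mid j)
    rewrite sym (+-swapʳ i 1ℤ (+ n)) | sym (+-swapʳ j 1ℤ (+ n)) | periodic i j | periodic (i + 1ℤ) j
          | periodic i (j + 1ℤ) | periodic (i + 1ℤ) (j + 1ℤ) = refl

  insertEar : Tiling → Tiling
  insertEar T = refine T σ σ-step

  insertEar-periodic : ∀ T → TilingPeriodic n T → TilingPeriodic N (insertEar T)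
  insertEar-periodic T periodic i j =
    trans (cong₂ (bracket T) (σ-translate i) (σ-translate j))
          (bracket-translate T periodic (σ i) (σ j))

  σ-small : ∀ {r} → r ℕ.< N → σ (+ r) ≡ vertex r 0ℤ
  σ-small {r} r<N = trans (cong σ (sym (+-identityʳ (+ r)))) (σ-decompose 0ℤ r<N)

  weight-before : ∀ {t} → t ℕ.< N → weight (σ (+ t)) ≡ indicator (t ℕ.≟ 0)
  weight-before {zero}  t<N = cong weight (σ-small t<N)
  weight-before {suc t} t<N = cong weight (σ-small t<N)

  -- The index `t + 2` lies between 2 and `N`, and there only `N`, the start of the next block, is
  -- an inserted vertex.
  weight-after : ∀ {t} → t ℕ.< n → weight (σ (+ suc t + 1ℤ)) ≡ indicator (suc t ℕ.≟ n)
  weight-after {t} t<n with suc t ℕ.≟ n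
  ... | yes refl = cong weight (trans (cong σ (cong (_+ 1ℤ) (sym (+-identityʳ (+ n))))) (σ-wrap 0ℤ))
  ... | no t+1≢n = cong weight
          (trans (cong σ (+-comm (+ suc t) 1ℤ)) (σ-small (ℕ.s≤s (ℕ.≤∧≢⇒< t<n t+1≢n))))

  module _ (T : Tiling) where

    cornerAt : ℤ → ℤ
    cornerAt i = entry T (i - 1ℤ) (i + 1ℤ)

    -- Index 0 is an inserted vertex, so the old vertex `t` has index `suc t`. Inserted neighbours
    -- occur only before the first and after the last old vertex of a block.
    insertEar-corner : ∀ {t} → t ℕ.< n →
      m (tilingFrieze (insertEar T)) (+ suc t) (+ suc t)
        ≡ cornerAt (+ t) + indicator (t ℕ.≟ 0) + indicator (suc t ℕ.≟ n)
    insertEar-corner {t} t<n = begin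
      bracket T (σ (+ t)) (σ (+ suc t + 1ℤ))
        ≡⟨ bracket-corner T
             (subst (Step (σ (+ t))) σ-here′ (σ-step (+ t)))
             (subst (λ v → Step v (σ (+ suc t + 1ℤ))) σ-here (σ-step (+ suc t))) ⟩
      cornerAt (+ t) + weight (σ (+ t)) + weight (σ (+ suc t + 1ℤ))
        ≡⟨ cong₂ (λ x y → cornerAt (+ t) + x + y)
             (weight-before (ℕ.m<n⇒m<1+n t<n)) (weight-after t<n) ⟩
      cornerAt (+ t) + indicator (t ℕ.≟ 0) + indicator (suc t ℕ.≟ n) ∎
      where
      open ≡-Reasoning
      σ-here : σ (+ suc t) ≡ at (+ t)
      σ-here = trans (σ-small (ℕ.s≤s t<n)) (cong at (+-identityʳ (+ t)))
      σ-here′ : σ (+ t + 1ℤ) ≡ at (+ t)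
      σ-here′ = trans (cong σ (+-comm (+ t) 1ℤ)) σ-here

    -- The inserted vertex is read at index `N` rather than 0, because `quiddity` lists the indices
    -- from 1 to `N`.
    insertEar-ear : m (tilingFrieze (insertEar T)) (+ N) (+ N) ≡ 1ℤ
    insertEar-ear = bracket-ear T
      (subst (Step (σ (+ n))) σ-ear (σ-step (+ n)))
      (subst (λ v → Step v (σ (+ N + 1ℤ))) (trans (cong σ (+-comm 1ℤ (+ n))) σ-ear) (σ-step (+ N)))
      where
      σ-ear : σ (+ n + 1ℤ) ≡ vertex 0 1ℤ
      σ-ear = trans (cong σ (cong (_+ 1ℤ) (sym (+-identityʳ (+ n))))) (σ-wrap 0ℤ)

-- Entries of the extended tuple.

toℕ-punchIn-< : ∀ {n} (i : Fin (suc n)) (j : Fin n) → toℕ j ℕ.< toℕ i →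
                toℕ (Fin.punchIn i j) ≡ toℕ j
toℕ-punchIn-< (Fin.suc i) Fin.zero    _   = refl
toℕ-punchIn-< (Fin.suc i) (Fin.suc j) j<i = cong suc (toℕ-punchIn-< i j (ℕ.s<s⁻¹ j<i))

toℕ-punchIn-≥ : ∀ {n} (i : Fin (suc n)) (j : Fin n) → toℕ i ℕ.≤ toℕ j →
                toℕ (Fin.punchIn i j) ≡ suc (toℕ j)
toℕ-punchIn-≥ Fin.zero    j           _   = refl
toℕ-punchIn-≥ (Fin.suc i) (Fin.suc j) i≤j = cong suc (toℕ-punchIn-≥ i j (ℕ.s≤s⁻¹ i≤j))

lookup-increment : ∀ {n} (q : Vec ℤ n) i j →
                   lookup (updateAt q i (_+ 1ℤ)) j ≡ lookup q j + indicator (toℕ j ℕ.≟ toℕ i)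
lookup-increment q i j with toℕ j ℕ.≟ toℕ i
... | no j≢i = trans (lookup∘updateAt′ j i (λ e → j≢i (cong toℕ e)) q) (sym (+-identityʳ _))
... | yes e with refl ← toℕ-injective e = lookup∘updateAt i q

-- `Fin.punchIn (Fin.suc k)` enumerates the positions other than that of the new 1. The indicators
-- stand in the order in which `insertEar-corner` produces them.
lookup-q̂-old : ∀ {n} (q : Vec ℤ (suc n)) (k j : Fin (suc n)) →
  lookup (q̂ q k) (Fin.punchIn (Fin.suc k) j)
    ≡ lookup q j + indicator (toℕ j ℕ.≟ suc (toℕ k) ℕ.% suc n) + indicator (toℕ j ℕ.≟ toℕ k)
lookup-q̂-old {zero}  (a ∷ []) Fin.zero Fin.zero = sym (+-assoc a 1ℤ 1ℤ)
lookup-q̂-old {suc n} q        k        j        = begin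
  lookup (insertAt (updateAt q′ k′ (_+ 1ℤ)) (Fin.suc k) 1ℤ) (Fin.punchIn (Fin.suc k) j)
    ≡⟨ insertAt-punchIn (updateAt q′ k′ (_+ 1ℤ)) (Fin.suc k) 1ℤ j ⟩
  lookup (updateAt q′ k′ (_+ 1ℤ)) j
    ≡⟨ lookup-increment q′ k′ j ⟩
  lookup q′ j + indicator (toℕ j ℕ.≟ toℕ k′)
    ≡⟨ cong₂ _+_ (lookup-increment q k j) (cong (λ x → indicator (toℕ j ℕ.≟ x)) (Fin.toℕ-fromℕ< _)) ⟩
  lookup q j + indicator (toℕ j ℕ.≟ toℕ k) + indicator (toℕ j ℕ.≟ suc (toℕ k) ℕ.% suc (suc n))
    ≡⟨ +-swapʳ (lookup q j) _ _ ⟩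
  lookup q j + indicator (toℕ j ℕ.≟ suc (toℕ k) ℕ.% suc (suc n)) + indicator (toℕ j ℕ.≟ toℕ k) ∎
  where
  open ≡-Reasoning
  q′ = updateAt q k (_+ 1ℤ)
  k′ = suc (toℕ k) mod suc (suc n)

lookup-q̂-new : ∀ {n} (q : Vec ℤ (suc n)) (k : Fin (suc n)) → lookup (q̂ q k) (Fin.suc k) ≡ 1ℤ
lookup-q̂-new {zero}  (a ∷ []) Fin.zero = refl
lookup-q̂-new {suc n} q        k        = insertAt-lookup
  (updateAt (updateAt q k (_+ 1ℤ)) (suc (toℕ k) mod suc (suc n)) (_+ 1ℤ)) (Fin.suc k) 1ℤ

lookup-quiddity : ∀ {n} F (p : Fin n) →
                  lookup (quiddity n F) p ≡ m F (+ suc (toℕ p)) (+ suc (toℕ p))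
lookup-quiddity F = lookup∘tabulate (λ p → m F (+ suc (toℕ p)) (+ suc (toℕ p)))

-- Matching the tuple with the new frieze up to rotation.

module _ {ℓ : ℕ} (F : InfiniteFrieze) (periodic : Periodic (suc ℓ) F) where

  private
    n N : ℕ
    n = suc ℓ
    N = suc n

  -- Zero-based like the positions of `quiddity`, but continued to all naturals, so that cyclic
  -- equivalence becomes addition of `s`.
  a : ℕ → ℤ
  a u = m F (+ suc u) (+ suc u)

  a-periodic : ∀ u x → a (u ℕ.+ x ℕ.* n) ≡ a u
  a-periodic u zero    = cong a (ℕ.+-identityʳ u)
  a-periodic u (suc x) = begin
    a (u ℕ.+ (n ℕ.+ x ℕ.* n)) ≡⟨ cong a (trans (cong (u ℕ.+_) (ℕ.+-comm n _)) (sym (ℕ.+-assoc u (x ℕ.* n) n))) ⟩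
    a (u ℕ.+ x ℕ.* n ℕ.+ n)   ≡⟨ periodic _ _ ≤-refl ⟨
    a (u ℕ.+ x ℕ.* n)         ≡⟨ a-periodic u x ⟩
    a u                       ∎
    where open ≡-Reasoning

  a-% : ∀ u → a (u ℕ.% n) ≡ a u
  a-% u = trans (sym (a-periodic (u ℕ.% n) (u ℕ./ n))) (cong a (sym (ℕ.m≡m%n+[m/n]*n u n)))

  module _ (k : Fin n) (s : ℕ) where

    -- The offset makes vertex 0 of T carry the quiddity following a_k, so that
    -- the new vertices lie between -1 and 0 modulo n.
    T : Tiling
    T = shift (+ (2 ℕ.+ toℕ k ℕ.+ s)) (friezeTiling F)

    F̂ : InfiniteFrieze
    F̂ = tilingFrieze (insertEar ℓ T)

    F̂-periodic : Periodic N F̂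
    F̂-periodic = tilingFrieze-periodic (insertEar ℓ T)
      (insertEar-periodic ℓ T (shift-periodic _ (friezeTiling F) (friezeTiling-periodic F periodic)))

    -- Of the 2 in the offset of `T`, one unit leads to the position after `k`; the other is the
    -- difference between the argument of `a` and the frieze index.
    corner-T : ∀ t → cornerAt ℓ T (+ t) ≡ a (t ℕ.+ suc (toℕ k) ℕ.+ s)
    corner-T t = trans (cong₂ (friezeEntry F) (+-swapʳ (+ t) -1ℤ (+ c)) (+-swapʳ (+ t) 1ℤ (+ c)))
      (trans (friezeTiling-quiddity F (+ t + + c)) (cong (λ u → m F (+ u) (+ u)) f))
      where
      c = 2 ℕ.+ toℕ k ℕ.+ s
      f : t ℕ.+ c ≡ suc (t ℕ.+ suc (toℕ k) ℕ.+ s)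
      f = trans (ℕ.+-suc t _) (cong suc (sym (ℕ.+-assoc t (suc (toℕ k)) s)))

    lookup-F̂ : ∀ u {t} x → u ≡ t ℕ.+ x ℕ.* N → t ℕ.< N →
               lookup (quiddity N F̂) (u mod N) ≡ m F̂ (+ suc t) (+ suc t)
    lookup-F̂ u {t} x refl t<N = trans (lookup-quiddity F̂ (u mod N))
      (cong (λ r → m F̂ (+ suc r) (+ suc r))
        (trans (Fin.toℕ-fromℕ< _) (trans (ℕ.[m+kn]%n≡m%n t x N) (ℕ.m<n⇒m%n≡m t<N))))

    module _ (q : Vec ℤ n) (q≡a : ∀ p → lookup q p ≡ lookup (quiddity n F) ((toℕ p ℕ.+ s) mod n)) where

      lookup-q : ∀ p → lookup q p ≡ a (toℕ p ℕ.+ s)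
      lookup-q p = trans (q≡a p) (trans (lookup-quiddity F ((toℕ p ℕ.+ s) mod n))
        (trans (cong a (Fin.toℕ-fromℕ< _)) (a-% (toℕ p ℕ.+ s))))

      -- The old vertex `t` belongs to position `t + k + 1` modulo `n`. So the first vertex of a
      -- block matches the position after `k` and the last one matches `k`, which are the two
      -- incremented entries.
      lookup-q̂≡F̂ : ∀ j t x → t ℕ.+ suc (toℕ k) ≡ toℕ j ℕ.+ x ℕ.* n → t ℕ.< n →
                    lookup (q̂ q k) (Fin.punchIn (Fin.suc k) j) ≡ m F̂ (+ suc t) (+ suc t)
      lookup-q̂≡F̂ j t x eq t<n = begin
        lookup (q̂ q k) (Fin.punchIn (Fin.suc k) j)
          ≡⟨ lookup-q̂-old q k j ⟩
        lookup q j + indicator (toℕ j ℕ.≟ suc (toℕ k) ℕ.% n) + indicator (toℕ j ℕ.≟ toℕ k)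
          ≡⟨ cong₂ _+_ (cong₂ _+_ (trans (lookup-q j) corner) (indicator-⇔ next⇒first first⇒next _ _))
               (indicator-⇔ here⇒last last⇒here _ _) ⟩
        cornerAt ℓ T (+ t) + indicator (t ℕ.≟ 0) + indicator (suc t ℕ.≟ n)
          ≡⟨ insertEar-corner ℓ T t<n ⟨
        m F̂ (+ suc t) (+ suc t) ∎
        where
        open ≡-Reasoning
        corner : a (toℕ j ℕ.+ s) ≡ cornerAt ℓ T (+ t)
        corner = begin
          a (toℕ j ℕ.+ s)                  ≡⟨ a-periodic (toℕ j ℕ.+ s) x ⟨
          a (toℕ j ℕ.+ s ℕ.+ x ℕ.* n)      ≡⟨ cong a (f (toℕ j) s (x ℕ.* n)) ⟩
          a (toℕ j ℕ.+ x ℕ.* n ℕ.+ s)      ≡⟨ cong (λ u → a (u ℕ.+ s)) eq ⟨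
          a (t ℕ.+ suc (toℕ k) ℕ.+ s)      ≡⟨ corner-T t ⟨
          cornerAt ℓ T (+ t)               ∎
          where
          f : ∀ j s y → j ℕ.+ s ℕ.+ y ≡ j ℕ.+ y ℕ.+ s
          f = ℕ-solve-∀

        t%n≡t : t ℕ.% n ≡ t
        t%n≡t = ℕ.m<n⇒m%n≡m t<n

        j≡[t+k+1]%n : toℕ j ≡ (t ℕ.+ suc (toℕ k)) ℕ.% n
        j≡[t+k+1]%n = sym (trans (cong (ℕ._% n) eq)
          (trans (ℕ.[m+kn]%n≡m%n (toℕ j) x n) (ℕ.m<n⇒m%n≡m (toℕ<n j))))

        next⇒first : toℕ j ≡ suc (toℕ k) ℕ.% n → t ≡ 0
        next⇒first j≡ = begin
          t                   ≡⟨ t%n≡t ⟨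
          t ℕ.% n             ≡⟨ ℕ.[m+kn]%n≡m%n t y n ⟨
          (t ℕ.+ y ℕ.* n) ℕ.% n ≡⟨ cong (ℕ._% n) (ℕ.+-cancelˡ-≡ (toℕ j) _ _ g) ⟩
          x ℕ.* n ℕ.% n       ≡⟨ ℕ.m*n%n≡0 x n ⟩
          0                   ∎
          where
          -- This is 1 if `k` is the last position and 0 otherwise. Cancelling `toℕ j` leaves
          -- `t + y n = x n`, so `t` vanishes modulo `n`.
          y = suc (toℕ k) ℕ./ n
          f : ∀ j t z → j ℕ.+ (t ℕ.+ z) ≡ t ℕ.+ (j ℕ.+ z)
          f = ℕ-solve-∀
          g : toℕ j ℕ.+ (t ℕ.+ y ℕ.* n) ≡ toℕ j ℕ.+ x ℕ.* n
          g = begin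
            toℕ j ℕ.+ (t ℕ.+ y ℕ.* n)                     ≡⟨ f (toℕ j) t (y ℕ.* n) ⟩
            t ℕ.+ (toℕ j ℕ.+ y ℕ.* n)                     ≡⟨ cong (λ r → t ℕ.+ (r ℕ.+ y ℕ.* n)) j≡ ⟩
            t ℕ.+ (suc (toℕ k) ℕ.% n ℕ.+ y ℕ.* n)         ≡⟨ cong (t ℕ.+_) (ℕ.m≡m%n+[m/n]*n (suc (toℕ k)) n) ⟨
            t ℕ.+ suc (toℕ k)                             ≡⟨ eq ⟩
            toℕ j ℕ.+ x ℕ.* n                             ∎

        first⇒next : t ≡ 0 → toℕ j ≡ suc (toℕ k) ℕ.% n
        first⇒next refl = j≡[t+k+1]%n

        here⇒last : toℕ j ≡ toℕ k → suc t ≡ n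
        -- Cancelling `toℕ k` makes `suc t` a multiple of `n`, so `t`, being less than `n`, is
        -- `n - 1`.
        here⇒last j≡k = cong suc (trans (sym t%n≡t) (ℕ.%-pred-≡0 {t} {n}
          (trans (cong (ℕ._% n) (ℕ.+-cancelʳ-≡ (toℕ k) _ _ g)) (ℕ.m*n%n≡0 x n))))
          where
          g : suc t ℕ.+ toℕ k ≡ x ℕ.* n ℕ.+ toℕ k
          g = trans (sym (ℕ.+-suc t (toℕ k))) (trans eq
                (trans (cong (ℕ._+ x ℕ.* n) j≡k) (ℕ.+-comm (toℕ k) _)))

        last⇒here : suc t ≡ n → toℕ j ≡ toℕ k
        last⇒here refl = trans j≡[t+k+1]%n
          (trans (cong (ℕ._% n) (trans (ℕ.+-suc t (toℕ k)) (ℕ.+-comm n (toℕ k))))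
            (trans (ℕ.[m+n]%n≡m%n (toℕ k) n) (ℕ.m<n⇒m%n≡m (toℕ<n k))))

      q̂-isQuiddity : IsQuidditySequence (q̂ q k) F̂
      -- The new 1 is at position `k + 1` of the tuple and at the last position `n` of the quiddity
      -- of `F̂`; the rotation is the difference.
      q̂-isQuiddity = n ℕ.∸ suc (toℕ k) , go
        where
        c = n ℕ.∸ suc (toℕ k)
        k+c≡n : suc (toℕ k) ℕ.+ c ≡ n
        k+c≡n = ℕ.m+[n∸m]≡n (toℕ<n k)

        go-old : ∀ j → lookup (q̂ q k) (Fin.punchIn (Fin.suc k) j) ≡
                       lookup (quiddity N F̂) ((toℕ (Fin.punchIn (Fin.suc k) j) ℕ.+ c) mod N)
        go-old j with ℕ.<-≤-connex (toℕ j) (suc (toℕ k))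
        -- Before the new 1 positions are unchanged: rotation by `c` stays below `N`, while
        -- `t + k + 1` exceeds `j` by one old period.
        ... | inj₁ j≤k = trans (lookup-q̂≡F̂ j t 1 t+k+1≡j+n t<n)
                (sym (lookup-F̂ _ 0 e (ℕ.m<n⇒m<1+n t<n)))
          where
          t = toℕ j ℕ.+ c
          f : ∀ j c k → j ℕ.+ c ℕ.+ k ≡ j ℕ.+ (k ℕ.+ c)
          f = ℕ-solve-∀
          t+k+1≡j+n : t ℕ.+ suc (toℕ k) ≡ toℕ j ℕ.+ 1 ℕ.* n
          t+k+1≡j+n = trans (f (toℕ j) c (suc (toℕ k)))
            (cong (toℕ j ℕ.+_) (trans k+c≡n (sym (ℕ.*-identityˡ n))))
          t<n : t ℕ.< n
          t<n = subst (t ℕ.<_) k+c≡n (ℕ.+-monoˡ-< c j≤k)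
          e : toℕ (Fin.punchIn (Fin.suc k) j) ℕ.+ c ≡ t ℕ.+ 0
          e = trans (cong (ℕ._+ c) (toℕ-punchIn-< (Fin.suc k) j j≤k)) (sym (ℕ.+-identityʳ t))
        -- After the new 1 positions are raised by one: rotation wraps once around `N`, while
        -- `t + k + 1` is exactly `j`.
        ... | inj₂ k<j = trans (lookup-q̂≡F̂ j t 0 (trans t+k+1≡j (sym (ℕ.+-identityʳ _))) t<n)
                (sym (lookup-F̂ _ 1 e (ℕ.m<n⇒m<1+n t<n)))
          where
          t = toℕ j ℕ.∸ suc (toℕ k)
          t+k+1≡j : t ℕ.+ suc (toℕ k) ≡ toℕ j
          t+k+1≡j = ℕ.m∸n+n≡m k<j
          t<n : t ℕ.< n
          t<n = ℕ.≤-<-trans (ℕ.m∸n≤m (toℕ j) (suc (toℕ k))) (toℕ<n j)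
          f : ∀ t k c → 1 ℕ.+ (t ℕ.+ k) ℕ.+ c ≡ t ℕ.+ (1 ℕ.+ (k ℕ.+ c) ℕ.+ 0)
          f = ℕ-solve-∀
          e : toℕ (Fin.punchIn (Fin.suc k) j) ℕ.+ c ≡ t ℕ.+ 1 ℕ.* N
          e = begin
            toℕ (Fin.punchIn (Fin.suc k) j) ℕ.+ c        ≡⟨ cong (ℕ._+ c) (toℕ-punchIn-≥ (Fin.suc k) j k<j) ⟩
            suc (toℕ j) ℕ.+ c                            ≡⟨ cong (λ u → suc u ℕ.+ c) t+k+1≡j ⟨
            suc (t ℕ.+ suc (toℕ k)) ℕ.+ c                ≡⟨ f t (suc (toℕ k)) c ⟩
            t ℕ.+ (suc (suc (toℕ k) ℕ.+ c) ℕ.+ 0)        ≡⟨ cong (λ u → t ℕ.+ (suc u ℕ.+ 0)) k+c≡n ⟩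
            t ℕ.+ 1 ℕ.* N                                ∎
            where open ≡-Reasoning

        go : ∀ p → lookup (q̂ q k) p ≡ lookup (quiddity N F̂) ((toℕ p ℕ.+ c) mod N)
        go p with Fin.suc k Fin.≟ p
        ... | yes refl = trans (lookup-q̂-new q k) (sym (trans
                (lookup-F̂ _ 0 (trans k+c≡n (sym (ℕ.+-identityʳ n))) ℕ.≤-refl)
                (insertEar-ear ℓ T)))
        ... | no k+1≢p = subst (λ p → lookup (q̂ q k) p ≡ lookup (quiddity N F̂) ((toℕ p ℕ.+ c) mod N))
                (Fin.punchIn-punchOut k+1≢p) (go-old (Fin.punchOut k+1≢p))

proposition2p4 : (n : ℕ) → .{{_ : NonZero n}} →
    (F : InfiniteFrieze) → Periodic n F →
    (q : Vec ℤ n) → IsQuidditySequence q F →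
    (k : Fin n) →
    ∃[ F̂ ] (Periodic (suc n) F̂ × IsQuidditySequence (q̂ q k) F̂)
proposition2p4 (suc ℓ) F periodic q (s , q≡a) k =
  F̂ F periodic k s , F̂-periodic F periodic k s , q̂-isQuiddity F periodic k s q q≡a
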